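{- Let $J_4$ be the $3$-graph on vertex set $\{1,2,3,4,5\}$ with $3$-edges $123,124,125,134,135,145$. For every positive integer $n$, $$\mathrm{co^+ex}(n,J_4)\ge 4\left\lfloor\frac n7\right\rfloor,$$ and therefore $\gamma^+(J_4)\ge 4/7$.
   Context: A $3$-graph is a finite $3$-uniform hypergraph; an edge is written as the concatenation of its vertices. The minimum positive co-degree $\delta_2^+(H)$ of a non-empty $3$-graph $H$ is the maximum $k$ such that every pair of vertices contained in some edge of $H$ is contained in at least $k$ distinct edges of $H$; by convention it is $0$ if $H$ has no edges. A hypergraph is $F$-free if it has no (not necessarily induced) subhypergraph isomorphic to $F$. $\mathrm{co^+ex}(n,F)$ is the maximum of $\delta_2^+(H)$ over all $n$-vertex $F$-free $3$-graphs $H$, and $\gamma^+(F)=\lim_{n\to\infty}\mathrm{co^+ex}(n,F)/n$ (this limit exists). -}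

module Defs where

open import Data.Bool.Base using (Bool; true; false; T)
import Data.Bool.Properties as Bool
open import Data.Fin.Base using (Fin; zero; suc)
open import Data.Fin.Patterns using (0F; 1F; 2F; 3F; 4F)
import Data.Fin.Properties as Fin
open import Data.Fin.Subset using (Subset; ∣_∣; ⁅_⁆; _∪_)
open import Data.Fin.Subset.Properties using (∣p∣≤n)
open import Data.Integer.Base using (+_)
open import Data.List.Base using (List; []; _∷_)
open import Data.List.Relation.Unary.Any using (any?)
open import Data.Nat.Base using (ℕ; zero; suc; _≤_; z≤n; NonZero)
import Data.Nat.Properties as ℕ
open import Data.Product.Base using (Σ; ∃; ∃-syntax; _×_; _,_; proj₁; proj₂)
open import Data.Rational.Base as ℚ using (ℚ; 0ℚ; 1ℚ)
import Data.Rational.Properties as ℚ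
open import Data.Sum.Base using (_⊎_; inj₁; inj₂)
open import Data.Vec.Base using (tabulate)
import Data.Vec.Functional as Vector
import Data.Vec.Properties as Vec
open import Function.Base using (_∘_)
open import Function.Definitions using (Injective)
open import Level using (0ℓ)
open import Relation.Binary.Core using (Rel)
open import Relation.Binary.Definitions using (_Respects_; Reflexive; DecidableEquality; tri<; tri≈; tri>)
open import Relation.Binary.PropositionalEquality
  using (_≡_; _≢_; refl; sym; trans; cong; cong₂; subst)
open import Relation.Nullary.Decidable
  using (Dec; yes; no; ⌊_⌋; map′; _×-dec_; _→-dec_; ¬?; T?; from-yes)
open import Relation.Nullary.Negation using (¬_; contradiction)
open import Relation.Unary using (Decidable)

------------------------------------------------------------------------
-- Maxima of decidable sets of natural numbers

IsMaximum : (ℕ → Set) → ℕ → Set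
IsMaximum P k = P k × (∀ m → P m → m ≤ k)

-- The largest k ≤ b satisfying P, and 0 if there is none.
greatest : {P : ℕ → Set} → Decidable P → ℕ → ℕ
greatest P? zero = zero
greatest P? (suc b) with P? (suc b)
... | yes _ = suc b
... | no  _ = greatest P? b

greatest-isMaximum : {P : ℕ → Set} (P? : Decidable P) (b : ℕ) →
                     (∀ m → P m → m ≤ b) → ∃ P → IsMaximum P (greatest P? b)
greatest-isMaximum {P} P? zero bound (k , pk) =
  subst P (ℕ.n≤0⇒n≡0 (bound k pk)) pk , bound
greatest-isMaximum P? (suc b) bound ex with P? (suc b)
... | yes p = p , bound
... | no ¬p = greatest-isMaximum P? b
  (λ m pm → ℕ.≤-pred (ℕ.≤∧≢⇒< (bound m pm) λ { refl → ¬p pm })) ex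

greatest-cong : {P Q : ℕ → Set} (P? : Decidable P) (Q? : Decidable Q) →
                (∀ k → P k → Q k) → (∀ k → Q k → P k) →
                ∀ b → greatest P? b ≡ greatest Q? b
greatest-cong P? Q? f g zero = refl
greatest-cong P? Q? f g (suc b) with P? (suc b) | Q? (suc b)
... | yes _ | yes _ = refl
... | yes p | no ¬q = contradiction (f _ p) ¬q
... | no ¬p | yes q = contradiction (g _ q) ¬p
... | no  _ | no  _ = greatest-cong P? Q? f g b

------------------------------------------------------------------------
-- 3-graphs

EdgeSet : ℕ → Set
EdgeSet n = Fin n → Fin n → Fin n → Bool

-- The two symmetries generate all permutations of the three arguments,
-- so `distinct` makes any two vertices of an edge different.
record Is3Graph {n : ℕ} (edge : EdgeSet n) : Set where
  field
    swap₁₂   : ∀ u v w → edge u v w ≡ edge v u w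
    swap₂₃   : ∀ u v w → edge u v w ≡ edge u w v
    distinct : ∀ u v w → T (edge u v w) → u ≢ v

-- A 3-graph with vertex set Fin n; {u, v, w} is an edge iff edge u v w
-- is true.
record 3Graph (n : ℕ) : Set where
  constructor mk3Graph
  field
    edge     : EdgeSet n
    is3Graph : Is3Graph edge

  open Is3Graph is3Graph public

open 3Graph public using (edge)

NonEmpty : ∀ {n} → 3Graph n → Set
NonEmpty H = ∃[ u ] ∃[ v ] ∃[ w ] T (edge H u v w)

-- The number of edges containing u and v, an edge {u, v, w} being
-- determined by its third vertex w.
codegree : ∀ {n} → 3Graph n → Fin n → Fin n → ℕ
codegree H u v = ∣ tabulate (edge H u v) ∣

PositiveCodegrees≥ : ∀ {n} → 3Graph n → ℕ → Set
PositiveCodegrees≥ H k = ∀ u v → (∃[ w ] T (edge H u v w)) → k ≤ codegree H u v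

nonEmpty? : ∀ {n} (H : 3Graph n) → Dec (NonEmpty H)
nonEmpty? H = Fin.any? λ u → Fin.any? λ v → Fin.any? λ w → T? (edge H u v w)

positiveCodegrees≥? : ∀ {n} (H : 3Graph n) → Decidable (PositiveCodegrees≥ H)
positiveCodegrees≥? H k = Fin.all? λ u → Fin.all? λ v →
  (Fin.any? λ w → T? (edge H u v w)) →-dec (k ℕ.≤? codegree H u v)

-- Minimum positive co-degree.  No codegree exceeds n, so the search bound
-- n is harmless (see δ⁺-isMaximum).
δ⁺ : ∀ {n} → 3Graph n → ℕ
δ⁺ {n} H with nonEmpty? H
... | yes _ = greatest (positiveCodegrees≥? H) n
... | no  _ = 0

-- F is isomorphic to a (not necessarily induced) subhypergraph of H.
_⊆ᵍ_ : ∀ {m n} → 3Graph m → 3Graph n → Set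
_⊆ᵍ_ {m} {n} F H = Σ (Fin m → Fin n) λ f →
  Injective _≡_ _≡_ f × (∀ u v w → T (edge F u v w) → T (edge H (f u) (f v) (f w)))

Free : ∀ {m n} → 3Graph m → 3Graph n → Set
Free F H = ¬ (F ⊆ᵍ H)

AttainedBy : ∀ {m} (n : ℕ) → 3Graph m → ℕ → Set
AttainedBy n F k = Σ (3Graph n) λ H → Free F H × δ⁺ H ≡ k

------------------------------------------------------------------------
-- Decidability of AttainedBy, by exhaustive search through the finitely
-- many 3-graphs on Fin n up to pointwise equality of their edge sets

Searchable : (A : Set) → Rel A 0ℓ → Set₁
Searchable A _≈_ = {P : A → Set} → Decidable P → P Respects _≈_ → Dec (∃ P)

search-Bool : Searchable Bool _≡_
search-Bool P? _ with P? true | P? false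
... | yes p | _     = yes (true , p)
... | no  _ | yes q = yes (false , q)
... | no ¬p | no ¬q = no λ { (true , p) → ¬p p ; (false , q) → ¬q q }

search-Fin : ∀ {n} → Searchable (Fin n) _≡_
search-Fin P? _ = Fin.any? P?

module _ {A : Set} {_≈_ : Rel A 0ℓ} (≈-refl : Reflexive _≈_) (search : Searchable A _≈_) where

  search-→ : ∀ n → Searchable (Fin n → A) (λ f g → ∀ i → f i ≈ g i)
  search-→ zero P? resp =
    map′ (λ p → Vector.[] , p) (λ { (f , p) → resp (λ ()) p }) (P? Vector.[])
  search-→ (suc n) P? resp =
    map′ (λ { (a , f , p) → (a Vector.∷ f) , p })
         (λ { (f , p) → f zero , f ∘ suc ,
                        resp (λ { zero → ≈-refl ; (suc _) → ≈-refl }) p })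
         (search
           (λ a → search-→ n (λ f → P? (a Vector.∷ f))
             (λ f≈g → resp λ { zero → ≈-refl ; (suc i) → f≈g i }))
           (λ { a≈b (f , p) → f , resp (λ { zero → a≈b ; (suc _) → ≈-refl }) p }))

_≗₃_ : ∀ {n} → Rel (EdgeSet n) 0ℓ
E ≗₃ E′ = ∀ u v w → E u v w ≡ E′ u v w

search-EdgeSet : ∀ n → Searchable (EdgeSet n) _≗₃_
search-EdgeSet n =
  search-→ (λ _ _ → refl) (search-→ (λ _ → refl) (search-→ refl search-Bool n) n) n

is3Graph? : ∀ {n} → Decidable (Is3Graph {n})
is3Graph? E = map′
  (λ { (a , b , c) → record { swap₁₂ = a ; swap₂₃ = b ; distinct = c } })
  (λ g → let open Is3Graph g in swap₁₂ , swap₂₃ , distinct)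
  (     (Fin.all? λ u → Fin.all? λ v → Fin.all? λ w → E u v w Bool.≟ E v u w)
  ×-dec (Fin.all? λ u → Fin.all? λ v → Fin.all? λ w → E u v w Bool.≟ E u w v)
  ×-dec (Fin.all? λ u → Fin.all? λ v → Fin.all? λ w →
           T? (E u v w) →-dec ¬? (u Fin.≟ v)))

_⊆ᵍ?_ : ∀ {m n} (F : 3Graph m) (H : 3Graph n) → Dec (F ⊆ᵍ H)
_⊆ᵍ?_ {m} F H = search-→ refl search-Fin m
  (λ f →
    map′ (λ inj {x} {y} → inj x y) (λ inj x y → inj {x} {y})
      (Fin.all? λ x → Fin.all? λ y → (f x Fin.≟ f y) →-dec (x Fin.≟ y))
    ×-dec (Fin.all? λ u → Fin.all? λ v → Fin.all? λ w →
      T? (edge F u v w) →-dec T? (edge H (f u) (f v) (f w))))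
  (λ { {f} {g} f≗g (inj , hom) →
      (λ {x} {y} eq → inj (trans (f≗g x) (trans eq (sym (f≗g y)))))
    , (λ u v w e → subst T
        (trans (cong (λ x → edge H x (f v) (f w)) (f≗g u))
               (cong₂ (edge H (g u)) (f≗g v) (f≗g w)))
        (hom u v w e)) })

module _ {n : ℕ} {H H′ : 3Graph n} (eq : edge H ≗₃ edge H′) where

  ⊆ᵍ-respʳ : ∀ {m} (F : 3Graph m) → F ⊆ᵍ H → F ⊆ᵍ H′
  ⊆ᵍ-respʳ F (f , inj , hom) = f , inj , λ u v w e → subst T (eq _ _ _) (hom u v w e)

  NonEmpty-resp : NonEmpty H → NonEmpty H′
  NonEmpty-resp (u , v , w , e) = u , v , w , subst T (eq u v w) e

  codegree-cong : ∀ u v → codegree H u v ≡ codegree H′ u v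
  codegree-cong u v = cong ∣_∣ (Vec.tabulate-cong (eq u v))

  PositiveCodegrees≥-resp : ∀ k → PositiveCodegrees≥ H k → PositiveCodegrees≥ H′ k
  PositiveCodegrees≥-resp k p u v (w , e) =
    subst (k ≤_) (codegree-cong u v) (p u v (w , subst T (sym (eq u v w)) e))

δ⁺-cong : ∀ {n} {H H′ : 3Graph n} → edge H ≗₃ edge H′ → δ⁺ H ≡ δ⁺ H′
δ⁺-cong {n} {H} {H′} eq with nonEmpty? H | nonEmpty? H′
... | yes _ | yes _ = greatest-cong _ _
  (PositiveCodegrees≥-resp {H = H} {H′} eq)
  (PositiveCodegrees≥-resp {H = H′} {H} (λ u v w → sym (eq u v w))) n
... | yes p | no ¬q = contradiction (NonEmpty-resp {H = H} {H′} eq p) ¬q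
... | no ¬p | yes q =
  contradiction (NonEmpty-resp {H = H′} {H} (λ u v w → sym (eq u v w)) q) ¬p
... | no  _ | no  _ = refl

attainedBy? : ∀ {m} n (F : 3Graph m) → Decidable (AttainedBy n F)
attainedBy? n F k = map′
  (λ { (E , g , p) → mk3Graph E g , p })
  (λ { (mk3Graph E g , p) → E , g , p })
  (search-EdgeSet n P? resp)
  where
  P : EdgeSet n → Set
  P E = Σ (Is3Graph E) λ g → Free F (mk3Graph E g) × δ⁺ (mk3Graph E g) ≡ k

  P? : Decidable P
  P? E with is3Graph? E
  ... | no ¬g = no (¬g ∘ proj₁)
  ... | yes g = map′ (g ,_)
    (λ { (g′ , free , δ≡k) →
           free , trans (δ⁺-cong {H = mk3Graph E g} {mk3Graph E g′} (λ _ _ _ → refl)) δ≡k })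
    (¬? (F ⊆ᵍ? mk3Graph E g) ×-dec (δ⁺ (mk3Graph E g) ℕ.≟ k))

  resp : P Respects _≗₃_
  resp {E} {E′} eq (g , free , δ≡k) = g′ ,
    free ∘ ⊆ᵍ-respʳ {H = mk3Graph E′ g′} {mk3Graph E g} (λ u v w → sym (eq u v w)) F ,
    trans (sym (δ⁺-cong {H = mk3Graph E g} {mk3Graph E′ g′} eq)) δ≡k
    where
    open Is3Graph g
    g′ : Is3Graph E′
    g′ = record
      { swap₁₂   = λ u v w → trans (sym (eq u v w)) (trans (swap₁₂ u v w) (eq v u w))
      ; swap₂₃   = λ u v w → trans (sym (eq u v w)) (trans (swap₂₃ u v w) (eq u w v))
      ; distinct = λ u v w e → distinct u v w (subst T (sym (eq u v w)) e)
      }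

------------------------------------------------------------------------
-- Positive co-degree Turán numbers

-- The maximum of δ⁺ H over all F-free 3-graphs H on n vertices.  Since
-- δ⁺ H ≤ n, the search bound n is harmless (see co⁺ex-isMaximum).
-- If no 3-graph on n vertices is F-free (possible only when F has no
-- edges) the value is 0.
co⁺ex : ∀ {m} → ℕ → 3Graph m → ℕ
co⁺ex n F = greatest (attainedBy? n F) n

positiveCodegrees≥-bound : ∀ {n} (H : 3Graph n) → NonEmpty H →
                           ∀ k → PositiveCodegrees≥ H k → k ≤ n
positiveCodegrees≥-bound H (u , v , w , e) k p =
  ℕ.≤-trans (p u v (w , e)) (∣p∣≤n (tabulate (edge H u v)))

δ⁺-isMaximum : ∀ {n} (H : 3Graph n) → NonEmpty H →
               IsMaximum (PositiveCodegrees≥ H) (δ⁺ H)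
δ⁺-isMaximum {n} H ne with nonEmpty? H
... | yes _ = greatest-isMaximum (positiveCodegrees≥? H) n
                (positiveCodegrees≥-bound H ne) (0 , λ _ _ _ → z≤n)
... | no ¬e = contradiction ne ¬e

δ⁺-empty : ∀ {n} (H : 3Graph n) → ¬ NonEmpty H → δ⁺ H ≡ 0
δ⁺-empty H ¬ne with nonEmpty? H
... | yes ne = contradiction ne ¬ne
... | no  _  = refl

δ⁺≤n : ∀ {n} (H : 3Graph n) → δ⁺ H ≤ n
δ⁺≤n H with nonEmpty? H in eq
... | no  _  = z≤n
... | yes ne = positiveCodegrees≥-bound H ne _
  (proj₁ (greatest-isMaximum (positiveCodegrees≥? H) _
    (positiveCodegrees≥-bound H ne) (0 , λ _ _ _ → z≤n)))

co⁺ex-isMaximum : ∀ {m} n (F : 3Graph m) → (Σ (3Graph n) (Free F)) →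
                  IsMaximum (AttainedBy n F) (co⁺ex n F)
co⁺ex-isMaximum n F (H , free) = greatest-isMaximum (attainedBy? n F) n
  (λ { _ (H′ , _ , refl) → δ⁺≤n H′ }) (δ⁺ H , H , free , refl)

------------------------------------------------------------------------
-- The 3-graph J₄, whose vertices 1, …, 5 are represented by 0F, …, 4F

triple : ∀ {n} → Fin n → Fin n → Fin n → Subset n
triple u v w = ⁅ u ⁆ ∪ ⁅ v ⁆ ∪ ⁅ w ⁆

J₄-edges : List (Subset 5)
J₄-edges = triple 0F 1F 2F ∷ triple 0F 1F 3F ∷ triple 0F 1F 4F
         ∷ triple 0F 2F 3F ∷ triple 0F 2F 4F ∷ triple 0F 3F 4F ∷ []

_≟ˢ_ : ∀ {n} → DecidableEquality (Subset n)
_≟ˢ_ = Vec.≡-dec Bool._≟_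

J₄-edge : EdgeSet 5
J₄-edge u v w = ⌊ any? (triple u v w ≟ˢ_) J₄-edges ⌋

J₄ : 3Graph 5
J₄ = mk3Graph J₄-edge (from-yes (is3Graph? J₄-edge))

------------------------------------------------------------------------
-- Real numbers (Dedekind cuts) and limits of rational sequences

-- L q means q < x and U q means x < q.
record ℝ : Set₁ where
  field
    L U         : ℚ → Set
    L-inhabited : ∃ L
    U-inhabited : ∃ U
    L-lower     : ∀ {p q} → p ℚ.< q → L q → L p
    U-upper     : ∀ {p q} → p ℚ.< q → U p → U q
    L-rounded   : ∀ {p} → L p → ∃[ q ] p ℚ.< q × L q
    U-rounded   : ∀ {q} → U q → ∃[ p ] p ℚ.< q × U p
    disjoint    : ∀ {q} → ¬ (L q × U q)
    located     : ∀ {p q} → p ℚ.< q → L p ⊎ U q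

open ℝ using (L; U)

_≤ℝ_ : ℝ → ℝ → Set
x ≤ℝ y = ∀ q → L x q → L y q

fromℚ : ℚ → ℝ
fromℚ r = record
  { L           = ℚ._< r
  ; U           = r ℚ.<_
  ; L-inhabited = r ℚ.- 1ℚ , subst (r ℚ.- 1ℚ ℚ.<_) (ℚ.+-identityʳ r)
                               (ℚ.+-monoʳ-< r (from-yes (ℚ.- 1ℚ ℚ.<? 0ℚ)))
  ; U-inhabited = r ℚ.+ 1ℚ , subst (ℚ._< r ℚ.+ 1ℚ) (ℚ.+-identityʳ r)
                               (ℚ.+-monoʳ-< r (from-yes (0ℚ ℚ.<? 1ℚ)))
  ; L-lower     = ℚ.<-trans
  ; U-upper     = λ p<q r<p → ℚ.<-trans r<p p<q
  ; L-rounded   = λ p<r → let (q , p<q , q<r) = ℚ.<-dense p<r in q , p<q , q<r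
  ; U-rounded   = λ r<q → let (p , r<p , p<q) = ℚ.<-dense r<q in p , p<q , r<p
  ; disjoint    = λ { (q<r , r<q) → ℚ.<-asym q<r r<q }
  ; located     = located
  }
  where
  located : ∀ {p q} → p ℚ.< q → p ℚ.< r ⊎ r ℚ.< q
  located {p} p<q with ℚ.<-cmp p r
  ... | tri< p<r _ _ = inj₁ p<r
  ... | tri≈ _ refl _ = inj₂ p<q
  ... | tri> _ _ r<p = inj₂ (ℚ.<-trans r<p p<q)

-- x is the limit of (a n) for n ≥ 1: the last line says ∣ a n - x ∣ < ε,
-- in the form a n - ε < x < a n + ε.
IsLimit : (∀ n → .{{NonZero n}} → ℚ) → ℝ → Set
IsLimit a x = ∀ ε → 0ℚ ℚ.< ε →
  ∃[ N ] ∀ n → .{{_ : NonZero n}} → N ≤ n →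
    L x (a n ℚ.- ε) × U x (a n ℚ.+ ε)

-- x = γ⁺(F).  The limit defining γ⁺(F) is a relation and not a function
-- because its existence as a located real is not constructively available.
_isγ⁺_ : ∀ {m} → ℝ → 3Graph m → Set
x isγ⁺ F = IsLimit (λ n → + co⁺ex n F ℚ./ n) x

{-# OPTIONS --safe #-}

-- J₄ ⊆ᵍ H says that some vertex link of H contains K₄.  In the complement
-- of the Fano plane each pair of points has codegree 4 and the link of a
-- point p is K₆ minus a perfect matching, since a line through p pairs its
-- two other points; such a link has no K₄.  Blowing up each point into at
-- least ⌊n/7⌋ vertices multiplies the codegrees accordingly and creates no
-- copy of J₄, because any two vertices of J₄ lie in a common edge.
-- Evaluating co⁺ex at multiples of 7 gives the bound on the limit.
module Submission where

open import Algebra.Properties.Group using (//-rightDividesˡ; ⁻¹-anti-homo-//)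
open import Data.Bool.Base using (Bool; true; false; T)
open import Data.Fin.Base using (Fin; suc; toℕ; _↑ˡ_; _↑ʳ_)
open import Data.Fin.Patterns using (0F; 1F; 2F; 3F; 4F; 5F; 6F)
import Data.Fin.Properties as Fin
open import Data.Fin.Subset using (Subset; ∣_∣)
open import Data.Integer.Base as ℤ using (+_; +≤+)
import Data.Integer.Properties as ℤ
open import Data.List.Base using (List; []; _∷_)
open import Data.List.Relation.Unary.Any using (any?)
open import Data.Nat.Base using (ℕ; zero; suc; _+_; _*_; _%_; _≤_; z≤n; NonZero)
open import Data.Nat.DivMod
  using (_/_; _mod_; m≡m%n+[m/n]*n; m<n⇒m%n≡m; [m+n]%n≡m%n; m*n/n≡m)
import Data.Nat.Properties as ℕ
open import Data.Product.Base using (∃-syntax; _×_; _,_; proj₁; proj₂)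
open import Data.Rational.Base as ℚ using (ℚ; 0ℚ)
import Data.Rational.Properties as ℚ
import Data.Rational.Unnormalised.Base as ℚᵘ
import Data.Rational.Unnormalised.Properties as ℚᵘ
open import Data.Vec.Base using (tabulate)
import Data.Vec.Properties as Vec
open import Function.Base using (_∘_)
open import Relation.Binary.Definitions using (tri<; tri≈; tri>)
open import Relation.Binary.PropositionalEquality
  using (_≡_; _≗_; refl; sym; trans; cong; cong₂; subst; subst₂)
open import Relation.Nullary.Decidable
  using (⌊_⌋; _×-dec_; _→-dec_; ¬?; T?; from-yes)
open import Relation.Nullary.Negation using (¬_; contradiction)
open import Defs

∣tabulate∣-cong : ∀ {n} {f g : Fin n → Bool} → f ≗ g → ∣ tabulate f ∣ ≡ ∣ tabulate g ∣
∣tabulate∣-cong f≗g = cong ∣_∣ (Vec.tabulate-cong f≗g)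

∣tabulate∣-+ : ∀ m n (f : Fin (m + n) → Bool) →
  ∣ tabulate f ∣ ≡ ∣ tabulate (f ∘ (_↑ˡ n)) ∣ + ∣ tabulate (f ∘ (m ↑ʳ_)) ∣
∣tabulate∣-+ zero    n f = refl
∣tabulate∣-+ (suc m) n f with f 0F
... | true  = cong suc (∣tabulate∣-+ m n (f ∘ suc))
... | false = ∣tabulate∣-+ m n (f ∘ suc)

module _ (d : ℕ) (f : ℕ → Bool) (periodic : ∀ i → f (d + i) ≡ f i) where

  -- Each of the `k` full periods contributes the same count, and the last `r` positions can only
  -- add to it.
  ∣tabulate∣-periodic : ∀ k r →
    k * ∣ tabulate {n = d} (f ∘ toℕ) ∣ ≤ ∣ tabulate {n = k * d + r} (f ∘ toℕ) ∣
  ∣tabulate∣-periodic zero    r = z≤n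
  ∣tabulate∣-periodic (suc k) r rewrite ℕ.+-assoc d (k * d) r = begin
    ∣ tabulate {n = d} (f ∘ toℕ) ∣ + k * ∣ tabulate {n = d} (f ∘ toℕ) ∣
      ≤⟨ ℕ.+-monoʳ-≤ _ (∣tabulate∣-periodic k r) ⟩
    ∣ tabulate {n = d} (f ∘ toℕ) ∣ + ∣ tabulate {n = m} (f ∘ toℕ) ∣
      ≡⟨ cong₂ _+_ (∣tabulate∣-cong {d} (cong f ∘ λ i → Fin.toℕ-↑ˡ i m)) (∣tabulate∣-cong shift) ⟨
    ∣ tabulate {n = d} (f ∘ toℕ ∘ (_↑ˡ m)) ∣ + ∣ tabulate {n = m} (f ∘ toℕ ∘ (d ↑ʳ_)) ∣
      ≡⟨ ∣tabulate∣-+ d m (f ∘ toℕ) ⟨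
    ∣ tabulate {n = d + m} (f ∘ toℕ) ∣
      ∎
    where
    open ℕ.≤-Reasoning
    m = k * d + r
    shift : f ∘ toℕ ∘ (d ↑ʳ_) ≗ f ∘ toℕ {n = m}
    shift i = trans (cong f (Fin.toℕ-↑ʳ d i)) (periodic (toℕ i))

module _ (d : ℕ) .{{_ : NonZero d}} where

  toℕ-mod : ∀ m → toℕ (m mod d) ≡ m % d
  toℕ-mod m = Fin.toℕ-fromℕ< _

  toℕ-mod-inverse : (i : Fin d) → toℕ i mod d ≡ i
  toℕ-mod-inverse i =
    Fin.toℕ-injective (trans (toℕ-mod (toℕ i)) (m<n⇒m%n≡m (Fin.toℕ<n i)))

  mod-periodic : ∀ m → (d + m) mod d ≡ m mod d
  mod-periodic m = Fin.toℕ-injective (trans (toℕ-mod (d + m))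
    (trans (cong (_% d) (ℕ.+-comm d m)) (trans ([m+n]%n≡m%n m d) (sym (toℕ-mod m)))))

module _ {d : ℕ} .{{_ : NonZero d}} (H : 3Graph d) (n : ℕ) where

  -- Residues split the vertices into `d` parts of at least `n / d` vertices each and make adjacency
  -- periodic in the vertex number.
  part : Fin n → Fin d
  part u = toℕ u mod d

  blowUp : 3Graph n
  blowUp = mk3Graph (λ u v w → edge H (part u) (part v) (part w)) record
    { swap₁₂   = λ u v w → swap₁₂ (part u) (part v) (part w)
    ; swap₂₃   = λ u v w → swap₂₃ (part u) (part v) (part w)
    ; distinct = λ { u v w e refl → distinct (part u) (part u) (part w) e refl }
    }
    where open 3Graph H

  codegree-blowUp : ∀ u v → n / d * codegree H (part u) (part v) ≤ codegree blowUp u v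
  codegree-blowUp u v = begin
    n / d * codegree H (part u) (part v)
      -- On the first period, the numbers below `d`, the residue map is the identity, so one period
      -- counts the codegree in `H`.
      ≡⟨ cong (n / d *_)
           (∣tabulate∣-cong (cong (edge H (part u) (part v)) ∘ toℕ-mod-inverse d)) ⟨
    n / d * ∣ tabulate {n = d} (adjacent ∘ toℕ) ∣
      ≤⟨ ∣tabulate∣-periodic d adjacent
           (cong (edge H (part u) (part v)) ∘ mod-periodic d) (n / d) (n % d) ⟩
    ∣ tabulate {n = n / d * d + n % d} (adjacent ∘ toℕ) ∣
      ≡⟨ cong (λ m → ∣ tabulate {n = m} (adjacent ∘ toℕ) ∣)
           (trans (ℕ.+-comm (n / d * d) (n % d)) (sym (m≡m%n+[m/n]*n n d))) ⟩
    codegree blowUp u v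
      ∎
    where
    open ℕ.≤-Reasoning
    adjacent : ℕ → Bool
    adjacent i = edge H (part u) (part v) (i mod d)

  positiveCodegrees≥-blowUp : ∀ {k} → PositiveCodegrees≥ H k →
                              PositiveCodegrees≥ blowUp (k * (n / d))
  positiveCodegrees≥-blowUp {k} p u v (w , e) = begin
    k * (n / d)                          ≡⟨ ℕ.*-comm k (n / d) ⟩
    n / d * k                            ≤⟨ ℕ.*-monoʳ-≤ (n / d) (p (part u) (part v) (part w , e)) ⟩
    n / d * codegree H (part u) (part v) ≤⟨ codegree-blowUp u v ⟩
    codegree blowUp u v                  ∎
    where open ℕ.≤-Reasoning

-- The edges themselves force the five vertices of a violation to be distinct. Each edge hypothesis
-- comes as early as possible, which prunes the exhaustive check on seven points.
K₄-FreeLinks : ∀ {n} → 3Graph n → Set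
K₄-FreeLinks H = ∀ p a b → T (edge H p a b) →
  ∀ c → T (edge H p a c) → T (edge H p b c) →
  ∀ d → T (edge H p a d) → T (edge H p b d) → ¬ T (edge H p c d)

-- The vertex `0F` lies in every edge of `J₄`, and the other four span a K₄ in its link. Projecting
-- a copy to the parts keeps all six edges and so puts a K₄ into a link of `H`.
blowUp-J₄-free : ∀ {d} .{{_ : NonZero d}} (H : 3Graph d) → K₄-FreeLinks H →
                 ∀ n → Free J₄ (blowUp H n)
blowUp-J₄-free H free n (f , _ , hom) =
  free (g 0F) (g 1F) (g 2F) (hom 0F 1F 2F _)
       (g 3F) (hom 0F 1F 3F _) (hom 0F 2F 3F _)
       (g 4F) (hom 0F 1F 4F _) (hom 0F 2F 4F _) (hom 0F 3F 4F _)
  where g = part H n ∘ f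

-- The translates of the perfect difference set {0, 1, 3} modulo 7.
FanoLines : List (Subset 7)
FanoLines = triple 0F 1F 3F ∷ triple 1F 2F 4F ∷ triple 2F 3F 5F ∷ triple 3F 4F 6F
          ∷ triple 4F 5F 0F ∷ triple 5F 6F 1F ∷ triple 6F 0F 2F ∷ []

FanoComplement-edge : EdgeSet 7
FanoComplement-edge u v w =
  ⌊ (∣ triple u v w ∣ ℕ.≟ 3) ×-dec ¬? (any? (triple u v w ≟ˢ_) FanoLines) ⌋

FanoComplement : 3Graph 7
FanoComplement = mk3Graph FanoComplement-edge (from-yes (is3Graph? FanoComplement-edge))

FanoComplement-codegrees : PositiveCodegrees≥ FanoComplement 4
FanoComplement-codegrees = from-yes (positiveCodegrees≥? FanoComplement 4)

FanoComplement-links : K₄-FreeLinks FanoComplement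
FanoComplement-links = from-yes
  (Fin.all? λ p → Fin.all? λ a → Fin.all? λ b → E? p a b →-dec
  (Fin.all? λ c → E? p a c →-dec (E? p b c →-dec
  (Fin.all? λ d → E? p a d →-dec (E? p b d →-dec ¬? (E? p c d))))))
  where E? = λ u v w → T? (FanoComplement-edge u v w)

≤co⁺ex : ∀ {m n} (F : 3Graph m) (H : 3Graph n) → Free F H → NonEmpty H →
         ∀ {k} → PositiveCodegrees≥ H k → k ≤ co⁺ex n F
≤co⁺ex {n = n} F H free ne p = ℕ.≤-trans
  (proj₂ (δ⁺-isMaximum H ne) _ p)
  (proj₂ (co⁺ex-isMaximum n F (H , free)) _ (H , free , refl))

4[n/7]≤co⁺ex-J₄ : ∀ n → 4 * (n / 7) ≤ co⁺ex n J₄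
-- Below 3 the quotient is 0. From 3 on, the vertices 0, 1, 2 lie in the parts 0, 1, 2 and form an
-- edge, as 012 is not a Fano line.
4[n/7]≤co⁺ex-J₄ 0 = z≤n
4[n/7]≤co⁺ex-J₄ 1 = z≤n
4[n/7]≤co⁺ex-J₄ 2 = z≤n
4[n/7]≤co⁺ex-J₄ n@(suc (suc (suc _))) = ≤co⁺ex J₄ (blowUp FanoComplement n)
  (blowUp-J₄-free FanoComplement FanoComplement-links n)
  (0F , 1F , 2F , _)
  (positiveCodegrees≥-blowUp FanoComplement n FanoComplement-codegrees)

-- `ℚ./` reduces to lowest terms; cross-multiplication is done on unnormalised fractions, which keep
-- `a`, `b`, `c`, `d`.
/-mono-≤ : ∀ a b c d .{{_ : NonZero b}} .{{_ : NonZero d}} →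
           a * d ≤ c * b → + a ℚ./ b ℚ.≤ + c ℚ./ d
/-mono-≤ a b@(suc _) c d@(suc _) ad≤cb = ℚ.toℚᵘ-cancel-≤ (begin
  ℚ.toℚᵘ (+ a ℚ./ b)  ≃⟨ ℚ.toℚᵘ-fromℚᵘ (+ a ℚᵘ./ b) ⟩
  + a ℚᵘ./ b          ≤⟨ ℚᵘ.*≤* (subst₂ ℤ._≤_ (ℤ.pos-* a d) (ℤ.pos-* c b) (+≤+ ad≤cb)) ⟩
  + c ℚᵘ./ d          ≃⟨ ℚ.toℚᵘ-fromℚᵘ (+ c ℚᵘ./ d) ⟨
  ℚ.toℚᵘ (+ c ℚ./ d)  ∎)
  where open ℚᵘ.≤-Reasoning

L-lower-≤ : ∀ (x : ℝ) {p q} → p ℚ.≤ q → ℝ.L x q → ℝ.L x p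
L-lower-≤ x {p} {q} p≤q Lq with ℚ.<-cmp p q
... | tri< p<q _ _  = ℝ.L-lower x p<q Lq
... | tri≈ _ refl _ = Lq
... | tri> _ _ q<p  = contradiction (ℚ.<-≤-trans q<p p≤q) (ℚ.<-irrefl refl)

-- For `q < r` take ε = r - q. A late term that is at least `r` then gives q ≤ a(n) - ε < x.
frequently-≥⇒≤limit : ∀ (a : ∀ n → .{{NonZero n}} → ℚ) (x : ℝ) r → IsLimit a x →
                      (∀ N → ∃[ n ] N ≤ suc n × r ℚ.≤ a (suc n)) → fromℚ r ≤ℝ x
frequently-≥⇒≤limit a x r lim often q q<r =
  let N , close      = lim (r ℚ.- q) 0<r-q
      n , N≤n , r≤an = often N
  in L-lower-≤ x (q≤an-[r-q] n r≤an) (proj₁ (close (suc n) N≤n))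
  where
  0<r-q : 0ℚ ℚ.< r ℚ.- q
  0<r-q = subst (ℚ._< r ℚ.- q) (ℚ.+-inverseʳ q) (ℚ.+-monoˡ-< (ℚ.- q) q<r)

  q≤an-[r-q] : ∀ n → r ℚ.≤ a (suc n) → q ℚ.≤ a (suc n) ℚ.- (r ℚ.- q)
  q≤an-[r-q] n r≤an = begin
    q                          ≡⟨ //-rightDividesˡ ℚ.+-0-group r q ⟨
    (q ℚ.- r) ℚ.+ r            ≡⟨ ℚ.+-comm (q ℚ.- r) r ⟩
    r ℚ.+ (q ℚ.- r)            ≡⟨ cong (r ℚ.+_) (⁻¹-anti-homo-// ℚ.+-0-group r q) ⟨
    r ℚ.- (r ℚ.- q)            ≤⟨ ℚ.+-monoˡ-≤ (ℚ.- (r ℚ.- q)) r≤an ⟩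
    a (suc n) ℚ.- (r ℚ.- q)    ∎
    where open ℚ.≤-Reasoning

module _ (c : ℕ → ℕ) (a d : ℕ) (a[n/1+d]≤c : ∀ n → a * (n / suc d) ≤ c n) where

  -- At multiples of `suc d` the floor in the hypothesis is exact, so nothing is lost on division by
  -- `n`.
  a/[1+d]≤c/n : ∀ k → let n = suc k * suc d in + a ℚ./ suc d ℚ.≤ + c n ℚ./ n
  a/[1+d]≤c/n k = /-mono-≤ a (suc d) (c n) n (begin
    a * n                      ≡⟨ ℕ.*-assoc a (suc k) (suc d) ⟨
    a * suc k * suc d          ≡⟨ cong (λ m → a * m * suc d) (m*n/n≡m (suc k) (suc d)) ⟨
    a * (n / suc d) * suc d    ≤⟨ ℕ.*-monoˡ-≤ (suc d) (a[n/1+d]≤c n) ⟩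
    c n * suc d                ∎)
    where
    open ℕ.≤-Reasoning
    n = suc k * suc d

  a/[1+d]≤limit : ∀ x → IsLimit (λ n → + c n ℚ./ n) x → fromℚ (+ a ℚ./ suc d) ≤ℝ x
  a/[1+d]≤limit x lim = frequently-≥⇒≤limit (λ n → + c n ℚ./ n) x (+ a ℚ./ suc d) lim λ N →
    -- The successor of this index is `suc N * suc d`, a multiple of `suc d` that is at least `N`.
    d + N * suc d ,
    ℕ.≤-trans (ℕ.m≤m*n N (suc d)) (ℕ.m≤n+m (N * suc d) (suc d)) ,
    a/[1+d]≤c/n N

mainTheorem10 : (∀ (n : ℕ) → .{{_ : NonZero n}} → 4 * (n / 7) ≤ co⁺ex n J₄)
    × (∀ (γ : ℝ) → γ isγ⁺ J₄ → fromℚ (+ 4 ℚ./ 7) ≤ℝ γ)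
mainTheorem10 =
    (λ n → 4[n/7]≤co⁺ex-J₄ n)
  , a/[1+d]≤limit (λ n → co⁺ex n J₄) 4 6 4[n/7]≤co⁺ex-J₄
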